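{- Let $G$ and $H$ be connected graphs with at least two vertices. If $o(H)\in\{\mathcal{N},\mathcal{S}\}$, then $o(G\odot H)=\mathcal{S}$.
   Context: All graphs are finite and simple. The corona product $G\odot H$ of a connected graph $G$ and a graph $H$ is obtained from one copy of $G$ and $n(G)=|V(G)|$ disjoint copies of $H$ by joining the $i$-th vertex of $G$ to every vertex of the $i$-th copy of $H$. A set $W\subseteq V(X)$ of a connected graph $X$ is a resolving set of $X$ if for every two distinct vertices $x,y$ of $X$ there is $z\in W$ such that the shortest-path distances $d_X(x,z)$ and $d_X(y,z)$ differ. The Maker-Breaker resolving game on a connected graph $X$ is played by two players, Resolver and Spoiler, who alternately select a not yet played vertex of $X$. Resolver wins if he selects all the vertices of some resolving set of $X$; Spoiler wins if she prevents this, i.e. if she selects at least one vertex from every resolving set of $X$. In the R-game Resolver moves first; in the S-game Spoiler moves first. The outcome $o(X)$ is: $\mathcal{R}$ if Resolver has a winning strategy no matter who starts the game; $\mathcal{S}$ if Spoiler has a winning strategy no matter who starts the game; $\mathcal{N}$ if the first player has a winning strategy (no matter which of the two players that is). It is known that $o(X)\in\{\mathcal{R},\mathcal{S},\mathcal{N}\}$ always holds. -}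

module Defs where

open import Data.Fin using (Fin)
open import Data.Fin.Properties using (+↔⊎; *↔×) renaming (_≟_ to _≟ᶠ_)
open import Data.List using (List; []; _∷_)
open import Data.List.Membership.Propositional using (_∈_; _∉_)
open import Data.List.Relation.Binary.Subset.Propositional using (_⊆_)
open import Data.Nat using (ℕ; zero; suc; _+_; _*_; _≤_)
open import Data.Product using (∃-syntax; _×_; _,_)
open import Data.Product.Function.NonDependent.Propositional using (_×-↔_)
open import Data.Sum using (_⊎_; inj₁; inj₂)
open import Data.Sum.Function.Propositional using (_⊎-↔_)
open import Function.Bundles using (_↔_)
open import Function.Construct.Composition using (_↔-∘_)
open import Function.Construct.Symmetry using (↔-sym)
open import Function.Properties.Inverse using (↔⇒↣)
open import Relation.Binary.Definitions using (Decidable; DecidableEquality; Irreflexive; Symmetric)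
open import Relation.Binary.PropositionalEquality using (_≡_; _≢_; refl)
open import Relation.Nullary.Decidable using (yes; no; map′; via-injection)

record Graph : Set₁ where
  field
    V          : Set
    order      : ℕ
    finite     : V ↔ Fin order
    Adj        : V → V → Set
    adj?       : Decidable Adj
    adj-sym    : Symmetric Adj
    adj-irrefl : Irreflexive _≡_ Adj

  _≟ⱽ_ : DecidableEquality V
  _≟ⱽ_ = via-injection (↔⇒↣ finite) _≟ᶠ_

module _ (X : Graph) where
  open Graph X

  data Walk : V → V → ℕ → Set where
    here : ∀ {x} → Walk x x zero
    step : ∀ {x y z k} → Adj x y → Walk y z k → Walk x z (suc k)

  Connected : Set
  Connected = ∀ x y → ∃[ k ] Walk x y k

  -- d(x , y) = k.
  Distance : V → V → ℕ → Set
  Distance x y k = Walk x y k × (∀ j → Walk x y j → k ≤ j)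

  -- d(x , z) ≠ d(y , z).  In a connected graph both distances exist and are
  -- unique, so this relational form is the inequality of two numbers.
  Resolves : V → V → V → Set
  Resolves z x y =
    ∃[ j ] ∃[ k ] (Distance x z j × Distance y z k × j ≢ k)

  -- Vertex subsets are lists; order and repetitions are irrelevant.
  IsResolvingSet : List V → Set
  IsResolvingSet W = ∀ x y → x ≢ y → ∃[ z ] (z ∈ W × Resolves z x y)

------------------------------------------------------------------------
-- The Maker-Breaker resolving game

data Player : Set where
  resolver spoiler : Player

opponent : Player → Player
opponent resolver = spoiler
opponent spoiler  = resolver

module _ (X : Graph) where
  open Graph X

  record Position : Set where
    constructor position
    field
      byResolver : List V
      bySpoiler  : List V

  open Position

  start : Position
  start = position [] []

  Unplayed : V → Position → Set
  Unplayed v p = v ∉ byResolver p × v ∉ bySpoiler p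

  select : Player → V → Position → Position
  select resolver v (position r s) = position (v ∷ r) s
  select spoiler  v (position r s) = position r (v ∷ s)

  HasWon : Player → Position → Set
  HasWon resolver p = ∃[ W ] (IsResolvingSet X W × W ⊆ byResolver p)
  HasWon spoiler  p = ∀ W → IsResolvingSet X W → ∃[ v ] (v ∈ W × v ∈ bySpoiler p)

  -- WinningStrategy P Q p: a strategy tree by which P wins from position p
  -- with Q to move.  A tree may stop once P has won, since further moves never
  -- undo HasWon.  The opponent must have a move available in `theirs`, so that
  -- P does not win vacuously on a full board.
  data WinningStrategy (P : Player) : Player → Position → Set where
    won    : ∀ {Q p} → HasWon P p → WinningStrategy P Q p
    ours   : ∀ {p} v → Unplayed v p →
             WinningStrategy P (opponent P) (select P v p) →
             WinningStrategy P P p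
    theirs : ∀ {p} → ∃[ v ] Unplayed v p →
             (∀ v → Unplayed v p →
               WinningStrategy P P (select (opponent P) v p)) →
             WinningStrategy P (opponent P) p

  WinsWhenStarting : Player → Player → Set
  WinsWhenStarting P first = WinningStrategy P first start

data Outcome : Set where
  𝓡 𝓢 𝓝 : Outcome

-- o(X) = 𝓞, as a relation.
HasOutcome : Graph → Outcome → Set
HasOutcome X 𝓡 = ∀ first → WinsWhenStarting X resolver first
HasOutcome X 𝓢 = ∀ first → WinsWhenStarting X spoiler first
HasOutcome X 𝓝 = ∀ first → WinsWhenStarting X first first

------------------------------------------------------------------------
-- Corona product

module _ (G H : Graph) where
  private
    module G = Graph G
    module H = Graph H

  -- inj₂ (g , h) is the vertex h of the copy of H attached to g.
  CoronaV : Set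
  CoronaV = G.V ⊎ (G.V × H.V)

  data CoronaAdj : CoronaV → CoronaV → Set where
    base : ∀ {g g′}   → G.Adj g g′ → CoronaAdj (inj₁ g) (inj₁ g′)
    copy : ∀ {g h h′} → H.Adj h h′ → CoronaAdj (inj₂ (g , h)) (inj₂ (g , h′))
    down : ∀ {g h}    → CoronaAdj (inj₁ g) (inj₂ (g , h))
    up   : ∀ {g h}    → CoronaAdj (inj₂ (g , h)) (inj₁ g)

  private
    adj? : Decidable CoronaAdj
    adj? (inj₁ g) (inj₁ g′) = map′ base (λ { (base a) → a }) (G.adj? g g′)
    adj? (inj₁ g) (inj₂ (g′ , h)) with g G.≟ⱽ g′
    ... | yes refl = yes down
    ... | no  g≢g′ = no λ { down → g≢g′ refl }
    adj? (inj₂ (g , h)) (inj₁ g′) with g G.≟ⱽ g′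
    ... | yes refl = yes up
    ... | no  g≢g′ = no λ { up → g≢g′ refl }
    adj? (inj₂ (g , h)) (inj₂ (g′ , h′)) with g G.≟ⱽ g′
    ... | yes refl = map′ copy (λ { (copy a) → a }) (H.adj? h h′)
    ... | no  g≢g′ = no λ { (copy _) → g≢g′ refl }

    adj-sym : Symmetric CoronaAdj
    adj-sym (base a) = base (G.adj-sym a)
    adj-sym (copy a) = copy (H.adj-sym a)
    adj-sym down     = up
    adj-sym up       = down

    adj-irrefl : Irreflexive _≡_ CoronaAdj
    adj-irrefl refl (base a) = G.adj-irrefl refl a
    adj-irrefl refl (copy a) = H.adj-irrefl refl a

    finite : CoronaV ↔ Fin (G.order + G.order * H.order)
    finite = ↔-sym +↔⊎ ↔-∘ (G.finite ⊎-↔ (↔-sym *↔× ↔-∘ (G.finite ×-↔ H.finite)))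

  infixl 7 _⊙_
  _⊙_ : Graph
  _⊙_ = record
    { V          = CoronaV
    ; order      = G.order + G.order * H.order
    ; finite     = finite
    ; Adj        = CoronaAdj
    ; adj?       = adj?
    ; adj-sym    = adj-sym
    ; adj-irrefl = adj-irrefl
    }

{-# OPTIONS --safe #-}
-- Vertices outside a copy of H do not distinguish two vertices of that copy, and
-- distances inside a copy are those of H truncated at 2, so a resolving set of
-- G ⊙ H traces a resolving set of H on every copy.  Hence Spoiler wins on G ⊙ H
-- as soon as she wins on one copy.  As G has two vertices, some copy is still
-- untouched at her first move; there she follows her strategy as first player on H.
-- A Resolver move outside the copy is harmless: she imagines that Resolver played
-- some vertex of the copy instead.
module Submission where

open import Defs
open import Data.Empty using (⊥-elim)
open import Data.Fin using (Fin; zero; suc)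
open import Data.Fin.Properties using (any?)
open import Data.List using (List; filter; map; allFin)
open import Data.List.Membership.Propositional using (_∈_)
open import Data.List.Membership.Propositional.Properties
  using (∈-allFin; ∈-filter⁺; ∈-filter⁻; ∈-map⁺)
import Data.List.Membership.DecPropositional as DecMembership
open import Data.List.Relation.Unary.Any using (here; there)
open import Data.Nat using (ℕ; zero; suc; _≤_; z≤n; s≤s)
open import Data.Nat.Properties using (≤-antisym; ≤-refl; ≤-trans; m≤n⇒m≤1+n)
open import Data.Product using (∃-syntax; _×_; _,_; proj₁; proj₂)
open import Data.Sum using (_⊎_; inj₁; inj₂; [_,_]′)
open import Function.Base using (_∘_)
open import Function.Bundles using (Inverse)
open import Relation.Binary.PropositionalEquality
  using (_≡_; _≢_; refl; sym; trans; cong; subst)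
open import Relation.Nullary using (¬_; Dec; yes; no)
open import Relation.Nullary.Decidable using (map′; _×-dec_)
open import Relation.Unary using (Decidable)

least : ∀ {P : ℕ → Set} → Decidable P → ∀ n → P n →
        ∃[ m ] (P m × (∀ j → P j → m ≤ j))
least P? n pn with P? 0
... | yes p0 = 0 , p0 , λ _ _ → z≤n
least P? zero    pn | no ¬p0 = ⊥-elim (¬p0 pn)
least P? (suc n) pn | no ¬p0 with least (P? ∘ suc) n pn
... | m , pm , min = suc m , pm , λ { zero p0 → ⊥-elim (¬p0 p0)
                                    ; (suc j) pj → s≤s (min j pj) }

module _ (X : Graph) where
  open Graph X
  open Inverse finite using (to; from; strictlyInverseʳ)

  any-vertex? : ∀ {P : V → Set} → Decidable P → Dec (∃[ v ] P v)
  any-vertex? {P} P? =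
    map′ (λ (i , p) → from i , p)
         (λ (v , p) → to v , subst P (sym (strictlyInverseʳ v)) p)
         (any? (P? ∘ from))

  vertices : List V
  vertices = map from (allFin order)

  ∈-vertices : ∀ v → v ∈ vertices
  ∈-vertices v = subst (_∈ vertices) (strictlyInverseʳ v) (∈-map⁺ from (∈-allFin (to v)))

  two-vertices : 2 ≤ order → ∃[ u ] ∃[ v ] u ≢ v
  two-vertices 2≤n with order | finite
  two-vertices (s≤s (s≤s _)) | suc (suc _) | fin =
    F.from zero , F.from (suc zero) , λ eq →
      0≢1 (trans (sym (F.strictlyInverseˡ zero))
                 (trans (cong F.to eq) (F.strictlyInverseˡ (suc zero))))
    where
    module F = Inverse fin
    0≢1 : ∀ {n} → _≢_ {A = Fin (suc (suc n))} zero (suc zero)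
    0≢1 ()

  walk? : ∀ x y → Decidable (Walk X x y)
  walk? x y zero = map′ (λ { refl → here }) (λ { here → refl }) (x ≟ⱽ y)
  walk? x y (suc k) =
    map′ (λ (_ , a , w) → step a w) (λ { (step a w) → _ , a , w })
         (any-vertex? λ z → adj? x z ×-dec walk? z y k)

  distance : Connected X → ∀ x y → ∃[ d ] Distance X x y d
  distance conn x y = let k , w = conn x y in least (walk? x y) k w

module _ (G H : Graph) where
  private
    module G = Graph G
    module H = Graph H
  open Graph (G ⊙ H) using (_≟ⱽ_)
  open DecMembership _≟ⱽ_ using (_∈?_)

  OutsideCopy : G.V → CoronaV G H → Set
  OutsideCopy g z = ∀ h → z ≢ inj₂ (g , h)

  -- The only exit from the copy is `inj₁ g`, which is adjacent to all of it, so everything up to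
  -- the exit can be replaced by a single step `up` from `y`.
  reroot-walk : ∀ {g x z k} y → OutsideCopy g z → Walk (G ⊙ H) (inj₂ (g , x)) z k →
                ∃[ j ] (Walk (G ⊙ H) (inj₂ (g , y)) z j × j ≤ k)
  reroot-walk y out here            = ⊥-elim (out _ refl)
  reroot-walk y out (step up w)     = _ , step up w , ≤-refl
  reroot-walk y out (step (copy _) w) =
    let j , w′ , j≤k = reroot-walk y out w in j , w′ , m≤n⇒m≤1+n j≤k

  outside-not-resolves : ∀ {g x y z} → OutsideCopy g z →
                         ¬ Resolves (G ⊙ H) z (inj₂ (g , x)) (inj₂ (g , y))
  outside-not-resolves out (j , k , (wj , minj) , (wk , mink) , j≢k) =
    let k′ , wk′ , k′≤j = reroot-walk _ out wj
        j′ , wj′ , j′≤k = reroot-walk _ out wk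
    in j≢k (≤-antisym (≤-trans (minj _ wj′) j′≤k) (≤-trans (mink _ wk′) k′≤j))

  copy-walk : ∀ {g x y k} → Walk H x y k → Walk (G ⊙ H) (inj₂ (g , x)) (inj₂ (g , y)) k
  copy-walk here       = here
  copy-walk (step a w) = step (copy a) (copy-walk w)

  short-walk : ∀ {g x y k} → Walk (G ⊙ H) (inj₂ (g , x)) (inj₂ (g , y)) k →
               Walk H x y k ⊎ 2 ≤ k
  short-walk here                     = inj₁ here
  short-walk (step (copy a) here)     = inj₁ (step a here)
  short-walk (step _ (step _ _))      = inj₂ (s≤s (s≤s z≤n))

  -- A shortest walk from `y` of length at most 1 is a walk of `H`, so `d ≤ k`, and the walk of
  -- length `d` from `x` can be copied. A longer one is matched by the detour from `x` through
  -- `inj₁ g`, of length 2.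
  copy-distance-mono : ∀ {g x y h d j k} → Distance H x h d → Distance H y h d →
    Distance (G ⊙ H) (inj₂ (g , x)) (inj₂ (g , h)) j →
    Distance (G ⊙ H) (inj₂ (g , y)) (inj₂ (g , h)) k → j ≤ k
  copy-distance-mono (wx , _) (_ , miny) (_ , minj) (wk , _) with short-walk wk
  ... | inj₁ w   = ≤-trans (minj _ (copy-walk wx)) (miny _ w)
  ... | inj₂ 2≤k = ≤-trans (minj _ (step up (step down here))) 2≤k

  copy-resolves : Connected H → ∀ {g h x y} →
    Resolves (G ⊙ H) (inj₂ (g , h)) (inj₂ (g , x)) (inj₂ (g , y)) → Resolves H h x y
  copy-resolves conn {h = h} {x} {y} (j , k , dj , dk , j≢k)
    with distance H conn x h | distance H conn y h
  ... | a , da | b , db = a , b , da , db , λ { refl →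
    j≢k (≤-antisym (copy-distance-mono da db dj dk) (copy-distance-mono db da dk dj)) }

  trace : G.V → List (CoronaV G H) → List H.V
  trace g W = filter (λ h → inj₂ (g , h) ∈? W) (vertices H)

  ∈-trace⁺ : ∀ {g h W} → inj₂ (g , h) ∈ W → h ∈ trace g W
  ∈-trace⁺ {g} {h} {W} = ∈-filter⁺ (λ h → inj₂ (g , h) ∈? W) (∈-vertices H h)

  ∈-trace⁻ : ∀ {g h W} → h ∈ trace g W → inj₂ (g , h) ∈ W
  ∈-trace⁻ {g} {h} {W} h∈ =
    proj₂ (∈-filter⁻ (λ h → inj₂ (g , h) ∈? W) {xs = vertices H} h∈)

  trace-resolving : Connected H → ∀ g {W} →
                    IsResolvingSet (G ⊙ H) W → IsResolvingSet H (trace g W)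
  trace-resolving conn g res x y x≢y
    with res (inj₂ (g , x)) (inj₂ (g , y)) (λ { refl → x≢y refl })
  ... | inj₁ _ , _ , r = ⊥-elim (outside-not-resolves (λ _ ()) r)
  ... | inj₂ (g′ , h) , z∈W , r with g′ G.≟ⱽ g
  ...   | yes refl = h , ∈-trace⁺ z∈W , copy-resolves conn r
  ...   | no g′≢g  = ⊥-elim (outside-not-resolves (λ { _ refl → g′≢g refl }) r)

  -- p is the position Spoiler imagines on the copy at g.  The actual position q is
  -- at least as good for her there: she may own more and Resolver less.
  record Dominates (g : G.V) (p : Position H) (q : Position (G ⊙ H)) : Set where
    constructor dominates
    open Position
    field
      keeps    : ∀ {h} → h ∈ bySpoiler p → inj₂ (g , h) ∈ bySpoiler q
      reflects : ∀ {h} → inj₂ (g , h) ∈ byResolver q → h ∈ byResolver p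
  open Dominates

  module _ {g : G.V} where

    dominates-spoiler : ∀ {p q h} → Dominates g p q →
      inj₂ (g , h) ∈ Position.bySpoiler q → Dominates g (select H spoiler h p) q
    dominates-spoiler D s = dominates (λ { (here refl) → s ; (there m) → keeps D m })
                                      (reflects D)

    dominates-select-spoiler : ∀ {p q h} → Dominates g p q →
      Dominates g (select H spoiler h p) (select (G ⊙ H) spoiler (inj₂ (g , h)) q)
    dominates-select-spoiler D =
      dominates (λ { (here refl) → here refl ; (there m) → there (keeps D m) })
                (reflects D)

    -- An extra Resolver vertex in `p` only weakens Spoiler's imagined position, so nothing in `q`
    -- has to match it.
    dominates-imagined : ∀ {p q h} → Dominates g p q →
                         Dominates g (select H resolver h p) q
    dominates-imagined D = dominates (keeps D) (there ∘ reflects D)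

    dominates-resolver : ∀ {p q w} → Dominates g p q →
      (∀ h → w ≡ inj₂ (g , h) → h ∈ Position.byResolver p) →
      Dominates g p (select (G ⊙ H) resolver w q)
    dominates-resolver D w∈ =
      dominates (keeps D) (λ { (here eq) → w∈ _ (sym eq) ; (there m) → reflects D m })

    module _ (conn : Connected H) where

      transfer-won : ∀ {p q} → Dominates g p q →
                     HasWon H spoiler p → HasWon (G ⊙ H) spoiler q
      transfer-won D win W res =
        let v , v∈W , v∈s = win (trace g W) (trace-resolving conn g res)
        in inj₂ (g , v) , ∈-trace⁻ v∈W , keeps D v∈s

      owned-or-unplayed : ∀ {p q v} → Dominates g p q → Unplayed H v p →
        inj₂ (g , v) ∈ Position.bySpoiler q ⊎ Unplayed (G ⊙ H) (inj₂ (g , v)) q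
      owned-or-unplayed {q = q} {v} D (v∉r , _) with inj₂ (g , v) ∈? Position.bySpoiler q
      ... | yes v∈s = inj₁ v∈s
      ... | no  v∉s = inj₂ (v∉r ∘ reflects D , v∉s)

      -- Supplies the free vertex that `theirs` demands on the actual board. With `q` fixed, one
      -- branch of the imagined game is followed until Spoiler's next vertex is free in `q` or she
      -- has won.
      won-or-unplayed : ∀ {Q p q} → Dominates g p q → WinningStrategy H spoiler Q p →
        HasWon (G ⊙ H) spoiler q ⊎ (∃[ w ] Unplayed (G ⊙ H) w q)
      won-or-unplayed D (won win) = inj₁ (transfer-won D win)
      won-or-unplayed D (ours v u t) with owned-or-unplayed D u
      ... | inj₁ s  = won-or-unplayed (dominates-spoiler D s) t
      ... | inj₂ u′ = inj₂ (_ , u′)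
      won-or-unplayed D (theirs (v , u) f) = won-or-unplayed (dominates-imagined D) (f v u)

      mutual
        -- `Q` is arbitrary because the imagined turn may differ from the actual one.
        spoiler-to-move : ∀ {Q p q} → Dominates g p q → WinningStrategy H spoiler Q p →
                          WinningStrategy (G ⊙ H) spoiler spoiler q
        spoiler-to-move D (won win) = won (transfer-won D win)
        spoiler-to-move D (ours v u t) with owned-or-unplayed D u
        -- The prescribed vertex is already hers, so only the imagined turn passes to Resolver;
        -- Spoiler still has her actual move.
        ... | inj₁ s  = spoiler-to-move (dominates-spoiler D s) t
        ... | inj₂ u′ = ours _ u′ (resolver-to-move (dominates-select-spoiler D) t)
        -- Resolver is imagined to play `v`, which brings the turns back in step.
        spoiler-to-move D (theirs (v , u) f) = spoiler-to-move (dominates-imagined D) (f v u)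

        resolver-to-move : ∀ {p q} → Dominates g p q → WinningStrategy H spoiler resolver p →
                           WinningStrategy (G ⊙ H) spoiler resolver q
        resolver-to-move D (won win) = won (transfer-won D win)
        resolver-to-move D t@(theirs (v , u) f) with won-or-unplayed D t
        ... | inj₁ win = won win
        ... | inj₂ w   = theirs w (answer D v u f)

        -- Here `v` is the default reply, imagined whenever the actual move `w` gives Resolver
        -- nothing new in `p`.
        answer : ∀ {p q} → Dominates g p q → ∀ v → Unplayed H v p →
          (∀ h → Unplayed H h p → WinningStrategy H spoiler spoiler (select H resolver h p)) →
          ∀ w → Unplayed (G ⊙ H) w q →
          WinningStrategy (G ⊙ H) spoiler spoiler (select (G ⊙ H) resolver w q)
        answer D v u f (inj₁ _) _ =
          spoiler-to-move (dominates-resolver (dominates-imagined D) (λ _ ())) (f v u)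
        answer {p} D v u f (inj₂ (g′ , h)) (_ , w∉s) with g′ G.≟ⱽ g
        ... | no g′≢g = spoiler-to-move
          (dominates-resolver (dominates-imagined D) (λ { _ refl → ⊥-elim (g′≢g refl) })) (f v u)
        ... | yes refl with DecMembership._∈?_ H._≟ⱽ_ h (Position.byResolver p)
        -- Resolver now really takes a vertex that was imagined as his earlier, so the default is
        -- imagined in its place.
        ...   | yes h∈r = spoiler-to-move
          (dominates-resolver (dominates-imagined D) (λ { _ refl → there h∈r })) (f v u)
        ...   | no h∉r = spoiler-to-move
          (dominates-resolver (dominates-imagined D) (λ { _ refl → here refl }))
          (f h (h∉r , w∉s ∘ keeps D))

  untouched-copy : 2 ≤ G.order → ∀ w → ∃[ g ] OutsideCopy g w
  untouched-copy 2≤n w with two-vertices G 2≤n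
  untouched-copy 2≤n (inj₁ _) | a , _ = a , λ _ ()
  untouched-copy 2≤n (inj₂ (g , _)) | a , b , a≢b with g G.≟ⱽ a
  ... | yes refl = b , λ { _ refl → a≢b refl }
  ... | no g≢a   = a , λ { _ refl → g≢a refl }

  spoiler-wins-corona : Connected H → 2 ≤ G.order →
    WinsWhenStarting H spoiler spoiler → HasOutcome (G ⊙ H) 𝓢
  spoiler-wins-corona conn 2≤n t spoiler =
    spoiler-to-move {g = proj₁ (two-vertices G 2≤n)} conn (dominates (λ ()) (λ ())) t
  spoiler-wins-corona conn 2≤n t resolver =
    theirs (inj₁ (proj₁ (two-vertices G 2≤n)) , (λ ()) , (λ ())) λ w _ →
      let g , out = untouched-copy 2≤n w in
      spoiler-to-move {g = g} conn
        (dominates-resolver (dominates (λ ()) (λ ())) (λ h eq → ⊥-elim (out h eq))) t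

proposition3p1 : (G H : Graph) → Connected G → Connected H →
    2 ≤ Graph.order G → 2 ≤ Graph.order H →
    HasOutcome H 𝓝 ⊎ HasOutcome H 𝓢 →
    HasOutcome (G ⊙ H) 𝓢
proposition3p1 G H _ connH 2≤G _ oH =
  spoiler-wins-corona G H connH 2≤G ([ (λ o → o spoiler) , (λ o → o spoiler) ]′ oH)
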